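{- Let $n,k\ge 0$ be integers. Suppose $P\subseteq Q_n$ is a convex subset of $Q_n$, ordered by the subset relation. Then $$w(P\times Q_k)\ge w(Q_{n+k})\,|P|\,2^{ -n}.$$
   Context: For an integer $m\ge 0$, $Q_m$ denotes the power set of a set with $m$ elements, partially ordered by the subset relation $\subseteq$ (so $|Q_m|=2^m$). A subset $S$ of a poset $(X,\le)$ is called convex if whenever $u\le v\le w$ in $X$ with $u,w\in S$, also $v\in S$ (equivalently, $S$ is the intersection of an upset and a downset of $X$); the empty set is convex. A subset of a poset is regarded as a poset with the induced order. If $X$ and $Y$ are posets, $X\times Y$ is the set of ordered pairs $(x,y)$ with $x\in X$, $y\in Y$, ordered by $(x_1,y_1)\le (x_2,y_2)$ if and only if $x_1\le x_2$ and $y_1\le y_2$. An antichain in a poset is a subset of pairwise incomparable elements. The width $w(X)$ of a finite poset $X$ is the maximum size of an antichain in $X$ (so $w(\emptyset)=0$). -}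

module Defs where

open import Data.Bool.Properties using () renaming (_≟_ to _≟ᵇ_)
open import Data.Fin.Base using (Fin)
open import Data.Fin.Properties using (injective⇒≤)
open import Data.Fin.Subset using (Subset; inside; outside)
open import Data.Fin.Subset.Properties using (⊆-isPartialOrder; _⊆?_)
open import Data.Integer.Base using (+_)
open import Data.List.Base
  using (List; []; _∷_; [_]; _++_; map; filter; length; lookup; cartesianProduct)
open import Data.List.Extrema.Nat using (max; xs≤max; argmax-sel)
open import Data.List.Membership.Propositional using (_∈_)
open import Data.List.Membership.Propositional.Properties
  using (∈-map⁺; ∈-map⁻; ∈-filter⁺; ∈-filter⁻; ∈-++⁺ˡ; ∈-++⁺ʳ; ∈-lookup)
import Data.List.Membership.Setoid
import Data.List.Membership.Setoid.Properties as Membershipₛ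
open import Data.List.Relation.Unary.All as All using (All; []; _∷_)
import Data.List.Relation.Unary.All.Properties as All
open import Data.List.Relation.Unary.AllPairs as AllPairs using (AllPairs; []; _∷_)
import Data.List.Relation.Unary.AllPairs.Properties as AllPairs
open import Data.List.Relation.Unary.Any as Any using (Any; here; there)
import Data.List.Relation.Unary.Any.Properties as Any
open import Data.List.Relation.Unary.Enumerates.Setoid using (IsEnumeration)
import Data.List.Relation.Unary.Enumerates.Setoid.Properties as Enumerates
open import Data.List.Relation.Unary.Unique.Setoid using (Unique)
import Data.List.Relation.Unary.Unique.Setoid.Properties as Unique
open import Data.Nat.Base as ℕ using (ℕ; zero; suc)
import Data.Nat.Properties as ℕ
open import Data.Product.Base using (∃; ∃-syntax; _×_; _,_; proj₁; proj₂)
open import Data.Product.Relation.Binary.Pointwise.NonDependent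
  using (×-poset; ×-decidable)
open import Data.Rational.Base using (ℚ; _/_)
open import Data.Sum.Base using (inj₁; inj₂)
open import Data.Vec.Base using ([]; _∷_)
open import Data.Vec.Properties using (≡-dec; ∷-injectiveʳ)
open import Level using (Level; _⊔_; 0ℓ)
open import Relation.Binary.Bundles using (Poset; DecPoset)
import Relation.Binary.Construct.On as On
open import Relation.Binary.Core using (Rel)
open import Relation.Binary.Definitions using (_Respects_)
open import Relation.Binary.PropositionalEquality
  using (_≡_; refl; sym; cong; subst; resp)
import Relation.Binary.PropositionalEquality.Properties as ≡
open import Relation.Nullary using (¬_; yes; no; ¬?; contradiction; _×-dec_)
open import Relation.Unary using (Pred; Decidable)

private
  variable
    a p c ℓ₁ ℓ₂ c′ ℓ₁′ ℓ₂′ : Level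
    A : Set a

module _ (X : Poset c ℓ₁ ℓ₂) where
  open Poset X

  Convex : Pred Carrier p → Set (c ⊔ ℓ₂ ⊔ p)
  Convex S = ∀ {u v w} → u ≤ v → v ≤ w → S u → S w → S v

  Incomparable : Rel Carrier ℓ₂
  Incomparable x y = ¬ (x ≤ y) × ¬ (y ≤ x)

  -- Since ≤ is reflexive, the members of such a list are pairwise distinct, so
  -- its length is the size of the antichain it lists.
  Antichain : Pred (List Carrier) (c ⊔ ℓ₂)
  Antichain = AllPairs Incomparable

record FinitePoset c ℓ₁ ℓ₂ : Set (Level.suc (c ⊔ ℓ₁ ⊔ ℓ₂)) where
  field
    decPoset : DecPoset c ℓ₁ ℓ₂

  open DecPoset decPoset public
  open Eq public using (setoid)

  field
    elements   : List Carrier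
    enumerates : IsEnumeration setoid elements
    unique     : Unique setoid elements

sublists : List A → List (List A)
sublists []       = [ [] ]
sublists (x ∷ xs) = map (x ∷_) (sublists xs) ++ sublists xs

module _ (X : FinitePoset c ℓ₁ ℓ₂) where
  open FinitePoset X

  size : ℕ
  size = length elements

  antichain? : Decidable (Antichain poset)
  antichain? = AllPairs.allPairs? λ x y → ¬? (x ≤? y) ×-dec ¬? (y ≤? x)

  antichains : List (List Carrier)
  antichains = filter antichain? (sublists elements)

  width : ℕ
  width = max 0 (map length antichains)

filter∈sublists : {P : Pred A p} (P? : Decidable P) (xs : List A) →
                  filter P? xs ∈ sublists xs
filter∈sublists P? []       = here refl
filter∈sublists P? (x ∷ xs) with P? x
... | yes _ = ∈-++⁺ˡ (∈-map⁺ (x ∷_) (filter∈sublists P? xs))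
... | no  _ = ∈-++⁺ʳ (map (x ∷_) (sublists xs)) (filter∈sublists P? xs)

module _ (X : FinitePoset c ℓ₁ ℓ₂) where
  open FinitePoset X hiding (refl)
  open Data.List.Membership.Setoid setoid using () renaming (_∈_ to _∈ₛ_)

  width-attained : ∃[ xs ] Antichain poset xs × length xs ≡ width X
  width-attained with argmax-sel (λ m → m) 0 (map length (antichains X))
  ... | inj₁ eq = [] , [] , sym eq
  ... | inj₂ ∈map with ∈-map⁻ length ∈map
  ...   | xs , xs∈ , eq =
    xs , proj₂ (∈-filter⁻ (antichain? X) {xs = sublists elements} xs∈) , sym eq

  private
    comparable⇒≈ : ∀ {xs x y} → Antichain poset xs → x ∈ₛ xs → y ∈ₛ xs →
                   x ≤ y → x ≈ y
    comparable⇒≈ (_ ∷ _)  (here x≈)  (here y≈)  _   = Eq.trans x≈ (Eq.sym y≈)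
    comparable⇒≈ (p ∷ _)  (here x≈)  (there y∈) x≤y with All.lookupAny p y∈
    ... | (≰ , _) , y≈ =
      contradiction (≤-respʳ-≈ y≈ (≤-respˡ-≈ x≈ x≤y)) ≰
    comparable⇒≈ (p ∷ _)  (there x∈) (here y≈)  x≤y with All.lookupAny p x∈
    ... | (_ , ≰) , x≈ =
      contradiction (≤-respʳ-≈ y≈ (≤-respˡ-≈ x≈ x≤y)) ≰
    comparable⇒≈ (_ ∷ ps) (there x∈) (there y∈) x≤y = comparable⇒≈ ps x∈ y∈ x≤y

    lookup-injective : ∀ {xs} → Antichain poset xs → (i j : Fin (length xs)) →
                       lookup xs i ≈ lookup xs j → i ≡ j
    lookup-injective (_ ∷ _)  Fin.zero    Fin.zero    _  = refl
    lookup-injective (p ∷ _)  Fin.zero    (Fin.suc j) eq =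
      contradiction (reflexive eq) (proj₁ (All.lookup p (∈-lookup j)))
    lookup-injective (p ∷ _)  (Fin.suc i) Fin.zero    eq =
      contradiction (reflexive eq) (proj₂ (All.lookup p (∈-lookup i)))
    lookup-injective (_ ∷ ps) (Fin.suc i) (Fin.suc j) eq =
      cong Fin.suc (lookup-injective ps i j eq)

    length-mono : ∀ {xs ys} → Antichain poset xs →
                  (∀ {x} → x ∈ₛ xs → x ∈ₛ ys) → length xs ℕ.≤ length ys
    length-mono {xs} {ys} anti ⊆ = injective⇒≤ {f = f} f-injective
      where
      mem : ∀ i → lookup xs i ∈ₛ ys
      mem i = ⊆ (Membershipₛ.∈-lookup setoid xs i)

      f : Fin (length xs) → Fin (length ys)
      f i = Any.index (mem i)

      f-injective : ∀ {i j} → f i ≡ f j → i ≡ j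
      f-injective {i} {j} eq = lookup-injective anti i j
        (Eq.trans (Any.lookup-index (mem i))
          (subst (λ k → lookup ys k ≈ lookup xs j) (sym eq)
            (Eq.sym (Any.lookup-index (mem j)))))

    unique⇒antichain : ∀ {xs} {ys : List Carrier} → Antichain poset xs →
                       All (_∈ₛ xs) ys → Unique setoid ys → Antichain poset ys
    unique⇒antichain anti []        []       = []
    unique⇒antichain anti (y∈ ∷ ∈s) (u ∷ us) =
      All.zipWith
        (λ (z∈ , y≉z) → (λ y≤z → y≉z (comparable⇒≈ anti y∈ z∈ y≤z))
                      , (λ z≤y → y≉z (Eq.sym (comparable⇒≈ anti z∈ y∈ z≤y))))
        (∈s , u)
      ∷ unique⇒antichain anti ∈s us

  length≤width : ∀ {xs} → Antichain poset xs → length xs ℕ.≤ width X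
  length≤width {xs} anti = ℕ.≤-trans (length-mono anti xs⊆ys)
    (All.lookup (xs≤max 0 (map length (antichains X)))
      (∈-map⁺ length (∈-filter⁺ (antichain? X)
        (filter∈sublists (_∈xs?) elements) ys-antichain)))
    where
    _∈xs? : Decidable (_∈ₛ xs)
    x ∈xs? = Any.any? (x ≟_) xs

    ys : List Carrier
    ys = filter _∈xs? elements

    xs⊆ys : ∀ {x} → x ∈ₛ xs → x ∈ₛ ys
    xs⊆ys = Membershipₛ.∈-filter⁺ setoid _∈xs?
      (Membershipₛ.∈-resp-≈ setoid) (enumerates _)

    ys-antichain : Antichain poset ys
    ys-antichain = unique⇒antichain anti (All.all-filter _∈xs? elements)
      (Unique.filter⁺ setoid _∈xs? unique)

module _ {P : Pred A p} (P? : Decidable P) where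

  select : List A → List (∃ P)
  select []       = []
  select (x ∷ xs) with P? x
  ... | yes px = (x , px) ∷ select xs
  ... | no  _  = select xs

  map-proj₁-select : ∀ xs → map proj₁ (select xs) ≡ filter P? xs
  map-proj₁-select []       = refl
  map-proj₁-select (x ∷ xs) with P? x
  ... | yes _ = cong (x ∷_) (map-proj₁-select xs)
  ... | no  _ = map-proj₁-select xs

module _ (X : FinitePoset c ℓ₁ ℓ₂) where
  open FinitePoset X

  -- Elements of the carrier ∃ P are compared through their first components, so
  -- different proofs of membership do not give different elements.
  subposet : {P : Pred Carrier p} → Decidable P → P Respects _≈_ →
             FinitePoset (c ⊔ p) ℓ₁ ℓ₂
  subposet {P = P} P? P-resp = record
    { decPoset   = On.decPoset decPoset (proj₁ {B = P})
    ; elements   = select P? elements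
    ; enumerates = λ (x , px) → Any.map⁻
        (subst (Any (x ≈_)) (sym (map-proj₁-select P? elements))
          (Membershipₛ.∈-filter⁺ setoid P? P-resp (enumerates x) px))
    ; unique     = AllPairs.map⁻
        (subst (Unique setoid) (sym (map-proj₁-select P? elements))
          (Unique.filter⁺ setoid P? unique))
    }

infixr 2 _×ᶠ_

_×ᶠ_ : FinitePoset c ℓ₁ ℓ₂ → FinitePoset c′ ℓ₁′ ℓ₂′ →
       FinitePoset (c ⊔ c′) (ℓ₁ ⊔ ℓ₁′) (ℓ₂ ⊔ ℓ₂′)
X ×ᶠ Y = record
  { decPoset   = record
    { isDecPartialOrder = record
      { isPartialOrder = Poset.isPartialOrder (×-poset X.poset Y.poset)
      ; _≟_            = ×-decidable X._≟_ Y._≟_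
      ; _≤?_           = ×-decidable X._≤?_ Y._≤?_
      }
    }
  ; elements   = cartesianProduct X.elements Y.elements
  ; enumerates = Enumerates.cartesianProduct⁺ X.setoid Y.setoid X.enumerates Y.enumerates
  ; unique     = Unique.cartesianProduct⁺ X.setoid Y.setoid X.unique Y.unique
  }
  where
  module X = FinitePoset X
  module Y = FinitePoset Y

subsets : ∀ m → List (Subset m)
subsets zero    = [ [] ]
subsets (suc m) = map (outside ∷_) (subsets m) ++ map (inside ∷_) (subsets m)

Q : ℕ → FinitePoset 0ℓ 0ℓ 0ℓ
Q m = record
  { decPoset   = record
    { isDecPartialOrder = record
      { isPartialOrder = ⊆-isPartialOrder m
      ; _≟_            = ≡-dec _≟ᵇ_
      ; _≤?_           = _⊆?_
      }
    }
  ; elements   = subsets m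
  ; enumerates = enum m
  ; unique     = uniq m
  }
  where
  enum : ∀ m (s : Subset m) → s ∈ subsets m
  enum zero    []            = here refl
  enum (suc m) (outside ∷ s) = ∈-++⁺ˡ (∈-map⁺ (outside ∷_) (enum m s))
  enum (suc m) (inside  ∷ s) =
    ∈-++⁺ʳ (map (outside ∷_) (subsets m)) (∈-map⁺ (inside ∷_) (enum m s))

  uniq : ∀ m → Unique (≡.setoid (Subset m)) (subsets m)
  uniq zero    = [] ∷ []
  uniq (suc m) = Unique.++⁺ S
    (Unique.map⁺ (≡.setoid _) S ∷-injectiveʳ (uniq m))
    (Unique.map⁺ (≡.setoid _) S ∷-injectiveʳ (uniq m))
    disjoint
    where
    S = ≡.setoid (Subset (suc m))

    disjoint : ∀ {s} → ¬ (s ∈ map (outside ∷_) (subsets m) ×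
                          s ∈ map (inside ∷_) (subsets m))
    disjoint (s∈ , s∈′) with ∈-map⁻ (outside ∷_) s∈ | ∈-map⁻ (inside ∷_) s∈′
    ... | _ , _ , refl | _ , _ , ()

⟨_⟩ : ∀ {n} {P : Pred (Subset n) p} → Decidable P → FinitePoset p 0ℓ 0ℓ
⟨_⟩ {n = n} {P} P? = subposet (Q n) P? (resp P)

fromℕ : ℕ → ℚ
fromℕ m = + m / 1

2^-_ : ℕ → ℚ
2^- n = _/_ (+ 1) (2 ℕ.^ n) ⦃ ℕ.m^n≢0 2 n ⦄

{-# OPTIONS --safe #-}

-- Suppose every p ∈ P carries an integer f p, with f strictly decreasing on P.
-- Then { (p , s) : ∣ s ∣ = f p } is an antichain of P × Q k, of size ∑ C(k, f p).
-- Induction on n gives such an f with 2ⁿ ∑ C(k, f p) ≥ C(n + k, c) ∣P∣, for any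
-- c.  Cut P ⊆ Q (n + 1) along the first coordinate into P₀ and P₁ and take f₀
-- and f₁ for these with k + 1 in place of k.  By Pascal's rule the two sums
-- together are ∑ C(k, ·) over the values f₀, f₀ − 1 on P₀ and f₁, f₁ − 1 on P₁,
-- and these values can be dealt out to two strictly decreasing functions on P:
--            on P₀               on P₁
--   lower :  f₀                  f₁ ⊓ (f₀ − 1)
--   upper :  f₁ ⊔ (f₀ − 1)       f₁ − 1
-- where the undefined f₀ or f₁ is dropped from ⊓ and ⊔ outside P₀ ∩ P₁.  The
-- better of the two is at least the average.  With c = ⌊(n + k)/2⌋ the theorem
-- follows from Sperner's theorem, w(Q m) ≤ C(m, ⌊m/2⌋).

module Submission where

open import Defs
open import Algebra.Properties.CommutativeSemigroup using (interchange)
open import Data.Bool.Base using (if_then_else_)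
open import Data.Fin.Base as Fin using (Fin)
import Data.Fin.Properties as Fin
open import Data.Fin.Subset using (Subset; inside; outside; _⊆_; ∣_∣)
open import Data.Fin.Subset.Properties
  using (drop-∷-⊆; out⊆; s⊆s; ⊆-refl; p⊆q⇒∣p∣≤∣q∣)
open import Data.Integer.Base as ℤ using (ℤ; +_; -[1+_]; pred)
import Data.Integer.Properties as ℤ
import Data.Integer.Tactic.RingSolver as ℤ-Solver
open import Data.List.Base
  using (List; []; _∷_; _++_; map; filter; length; cartesianProduct; partitionSums)
open import Data.List.Properties using (length-map; map-++; map-∘; map-cong)
open import Data.List.Relation.Unary.All as All using (All; []; _∷_)
import Data.List.Relation.Unary.All.Properties as All
open import Data.List.Relation.Unary.AllPairs as AllPairs using (AllPairs; []; _∷_)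
import Data.List.Relation.Unary.AllPairs.Properties as AllPairs
open import Data.Nat.Base as ℕ using (ℕ; zero; suc; _+_; z≤n; s≤s)
open import Data.Nat.ListAction using (sum)
open import Data.Nat.ListAction.Properties using (sum-++)
import Data.Nat.Properties as ℕ
open import Data.Nat.Tactic.RingSolver using (solve-∀)
open import Data.Product.Base using (∃-syntax; _×_; _,_; proj₁; proj₂)
import Data.Product.Relation.Binary.Pointwise.NonDependent as Product
open import Data.Rational.Base using (_≥_; _≤_; _*_; _/_; toℚᵘ)
import Data.Rational.Properties as ℚ
open import Data.Rational.Unnormalised.Base as ℚᵘ using (mkℚᵘ)
import Data.Rational.Unnormalised.Properties as ℚᵘ
open import Data.Sum.Base as Sum using (_⊎_; inj₁; inj₂)
open import Data.Sum.Relation.Binary.Pointwise using (⊎-poset; inj₁; inj₂)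
open import Data.Vec.Base using ([]; _∷_; here)
open import Function.Base using (_∘_; case_of_)
open import Level using (Level)
open import Relation.Binary.Bundles using (Poset)
open import Relation.Binary.PropositionalEquality
  using (_≡_; _≢_; refl; sym; trans; cong; cong₂; subst; subst₂; module ≡-Reasoning)
open import Relation.Nullary using (¬_; Dec; yes; no; does; contradiction)
open import Relation.Unary using (Pred; Decidable)

private
  variable
    a p : Level
    A B : Set a
    n k : ℕ

-- Indicators, binomial coefficients and sums over all subsets

⟦_⟧ : Dec A → ℕ
⟦ d ⟧ = if does d then 1 else 0

-- The binomial coefficient C(k, j), which is 0 outside 0 ≤ j ≤ k.
binom : ℕ → ℤ → ℕ
binom zero    j = ⟦ + 0 ℤ.≟ j ⟧
binom (suc k) j = binom k j + binom k (pred j)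

-- Recursion on the first coordinate matches both Pascal's rule in `binom` and the cut of P into its
-- two halves.
∑ : ∀ n → (Subset n → ℕ) → ℕ
∑ zero    h = h []
∑ (suc n) h = ∑ n (h ∘ (outside ∷_)) + ∑ n (h ∘ (inside ∷_))

∑-cong : ∀ n {h h′ : Subset n → ℕ} → (∀ p → h p ≡ h′ p) → ∑ n h ≡ ∑ n h′
∑-cong zero    eq = eq []
∑-cong (suc n) eq = cong₂ _+_ (∑-cong n (eq ∘ _)) (∑-cong n (eq ∘ _))

∑-+ : ∀ n (h h′ : Subset n → ℕ) → ∑ n (λ p → h p + h′ p) ≡ ∑ n h + ∑ n h′
∑-+ zero    h h′ = refl
∑-+ (suc n) h h′ = trans
  (cong₂ _+_ (∑-+ n (h ∘ (outside ∷_)) (h′ ∘ (outside ∷_)))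
             (∑-+ n (h ∘ (inside ∷_)) (h′ ∘ (inside ∷_))))
  (interchange ℕ.+-commutativeSemigroup (∑ n (h ∘ (outside ∷_))) _ _ _)

sum-map-subsets : ∀ n (h : Subset n → ℕ) → sum (map h (subsets n)) ≡ ∑ n h
sum-map-subsets zero    h = ℕ.+-identityʳ _
sum-map-subsets (suc n) h = begin
  sum (map h (map (outside ∷_) (subsets n) ++ map (inside ∷_) (subsets n)))
    ≡⟨ cong sum (map-++ h (map (outside ∷_) (subsets n)) _) ⟩
  sum (map h (map (outside ∷_) (subsets n)) ++ map h (map (inside ∷_) (subsets n)))
    ≡⟨ sum-++ (map h (map (outside ∷_) (subsets n))) _ ⟩
  sum (map h (map (outside ∷_) (subsets n))) + sum (map h (map (inside ∷_) (subsets n)))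
    ≡⟨ cong₂ _+_ (half outside) (half inside) ⟩
  ∑ (suc n) h ∎
  where
  open ≡-Reasoning
  half : ∀ b → sum (map h (map (b ∷_) (subsets n))) ≡ ∑ n (h ∘ (b ∷_))
  half b = trans (cong sum (sym (map-∘ (subsets n)))) (sum-map-subsets n (h ∘ (b ∷_)))

⟦≟⟧-suc : ∀ m j → ⟦ + suc m ℤ.≟ j ⟧ ≡ ⟦ + m ℤ.≟ pred j ⟧
⟦≟⟧-suc m j with + suc m ℤ.≟ j | + m ℤ.≟ pred j
... | yes _  | yes _  = refl
... | no  _  | no  _  = refl
... | yes eq | no ¬eq = contradiction (cong pred eq) ¬eq
... | no ¬eq | yes eq = contradiction (trans (cong ℤ.suc eq) (ℤ.suc-pred j)) ¬eq

-- Pascal's rule: a set of size j either avoids the first point, or contains it and has j - 1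
-- others.
∑-level : ∀ k j → ∑ k (λ s → ⟦ + ∣ s ∣ ℤ.≟ j ⟧) ≡ binom k j
∑-level zero    j = refl
∑-level (suc k) j = cong₂ _+_ (∑-level k j)
  (trans (∑-cong k (λ s → ⟦≟⟧-suc ∣ s ∣ j)) (∑-level k (pred j)))

length-filter-sum : {P : Pred A p} (P? : Decidable P) (xs : List A) →
                    length (filter P? xs) ≡ sum (map (⟦_⟧ ∘ P?) xs)
length-filter-sum P? []       = refl
length-filter-sum P? (x ∷ xs) with P? x
... | yes _ = cong suc (length-filter-sum P? xs)
... | no  _ = length-filter-sum P? xs

length-filter-subsets : {P : Pred (Subset n) p} (P? : Decidable P) →
                        length (filter P? (subsets n)) ≡ ∑ n (⟦_⟧ ∘ P?)
length-filter-subsets {n = n} P? =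
  trans (length-filter-sum P? (subsets n)) (sum-map-subsets n (⟦_⟧ ∘ P?))

sum-map-select : {P : Pred A p} (P? : Decidable P) (h : A → ℕ) (xs : List A) →
                 sum (map (h ∘ proj₁) (select P? xs)) ≡ sum (map (λ x → ⟦ P? x ⟧ ℕ.* h x) xs)
sum-map-select P? h []       = refl
sum-map-select P? h (x ∷ xs) with P? x
... | yes _ = cong₂ _+_ (sym (ℕ.*-identityˡ (h x))) (sum-map-select P? h xs)
... | no  _ = sum-map-select P? h xs

sum-map-cartesianProduct : (h : A × B → ℕ) (xs : List A) (ys : List B) →
                           sum (map h (cartesianProduct xs ys)) ≡
                           sum (map (λ x → sum (map (λ y → h (x , y)) ys)) xs)
sum-map-cartesianProduct h []       ys = refl
sum-map-cartesianProduct h (x ∷ xs) ys = begin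
  sum (map h (map (x ,_) ys ++ cartesianProduct xs ys))
    ≡⟨ cong sum (map-++ h (map (x ,_) ys) _) ⟩
  sum (map h (map (x ,_) ys) ++ map h (cartesianProduct xs ys))
    ≡⟨ sum-++ (map h (map (x ,_) ys)) _ ⟩
  sum (map h (map (x ,_) ys)) + sum (map h (cartesianProduct xs ys))
    ≡⟨ cong₂ _+_ (cong sum (sym (map-∘ ys))) (sum-map-cartesianProduct h xs ys) ⟩
  sum (map (λ y → h (x , y)) ys) + sum (map (λ x → sum (map (λ y → h (x , y)) ys)) xs) ∎
  where open ≡-Reasoning

size-⟨⟩ : {P : Pred (Subset n) p} (P? : Decidable P) → size ⟨ P? ⟩ ≡ ∑ n (⟦_⟧ ∘ P?)
size-⟨⟩ {n = n} P? = begin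
  length (select P? (subsets n))             ≡⟨ length-map proj₁ (select P? (subsets n)) ⟨
  length (map proj₁ (select P? (subsets n))) ≡⟨ cong length (map-proj₁-select P? (subsets n)) ⟩
  length (filter P? (subsets n))             ≡⟨ length-filter-subsets P? ⟩
  ∑ n (⟦_⟧ ∘ P?)                             ∎
  where open ≡-Reasoning

-- Antichains from strictly decreasing functions

StrictlyDecreasing : Pred (Subset n) p → (Subset n → ℤ) → Set p
StrictlyDecreasing P f = ∀ {p q} → P p → P q → p ⊆ q → p ≢ q → f q ℤ.< f p

⊆∧∣∣≡⇒≡ : (s t : Subset k) → s ⊆ t → ∣ s ∣ ≡ ∣ t ∣ → s ≡ t
⊆∧∣∣≡⇒≡ []            []            s⊆t eq = refl
⊆∧∣∣≡⇒≡ (outside ∷ s) (outside ∷ t) s⊆t eq = cong (outside ∷_) (⊆∧∣∣≡⇒≡ s t (drop-∷-⊆ s⊆t) eq)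
⊆∧∣∣≡⇒≡ (inside  ∷ s) (inside  ∷ t) s⊆t eq =
  cong (inside ∷_) (⊆∧∣∣≡⇒≡ s t (drop-∷-⊆ s⊆t) (ℕ.suc-injective eq))
⊆∧∣∣≡⇒≡ (inside  ∷ s) (outside ∷ t) s⊆t eq = contradiction (s⊆t here) λ ()
⊆∧∣∣≡⇒≡ (outside ∷ s) (inside  ∷ t) s⊆t eq =
  contradiction (p⊆q⇒∣p∣≤∣q∣ (drop-∷-⊆ s⊆t)) (ℕ.<⇒≱ (ℕ.≤-reflexive (sym eq)))

module _ {P : Pred (Subset n) p} (P? : Decidable P) (k : ℕ) where
  private
    module X = FinitePoset (⟨ P? ⟩ ×ᶠ Q k)

  ∑≤width : ∀ {f} → StrictlyDecreasing P f →
            ∑ n (λ p → ⟦ P? p ⟧ ℕ.* binom k (f p)) ℕ.≤ width (⟨ P? ⟩ ×ᶠ Q k)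
  ∑≤width {f} decreasing =
    subst (ℕ._≤ width (⟨ P? ⟩ ×ᶠ Q k)) length-levels
      (length≤width (⟨ P? ⟩ ×ᶠ Q k)
        (antichain (All.all-filter OnLevel? X.elements) (AllPairs.filter⁺ OnLevel? X.unique)))
    where
    OnLevel : Pred X.Carrier _
    OnLevel ((p , _) , s) = + ∣ s ∣ ≡ f p

    OnLevel? : Decidable OnLevel
    OnLevel? ((p , _) , s) = + ∣ s ∣ ℤ.≟ f p

    -- If p ≠ q, then ∣ t ∣ = f q < f p = ∣ s ∣, against s ⊆ t. If p = q, then s and t have the same
    -- size, so s ⊆ t forces s = t.
    ≤⇒≈ : ∀ {x y} → OnLevel x → OnLevel y → x X.≤ y → x X.≈ y
    ≤⇒≈ {(p , Pp) , s} {(q , Pq) , t} x∈ y∈ (p⊆q , s⊆t)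
      with FinitePoset._≟_ (Q n) p q
    ... | yes refl = refl , ⊆∧∣∣≡⇒≡ s t s⊆t (ℤ.+-injective (trans x∈ (sym y∈)))
    ... | no  p≢q  = contradiction (ℤ.+≤+ (p⊆q⇒∣p∣≤∣q∣ s⊆t))
      (ℤ.<⇒≱ (subst₂ ℤ._<_ (sym y∈) (sym x∈) (decreasing Pp Pq p⊆q p≢q)))

    antichain : ∀ {xs} → All OnLevel xs → AllPairs (λ x y → ¬ x X.≈ y) xs →
                Antichain X.poset xs
    antichain []         []       = []
    antichain {x ∷ _} (x∈ ∷ xs∈) (u ∷ us) =
      All.zipWith (λ {y} (y∈ , x≉y) →
          (λ x≤y → x≉y (≤⇒≈ {x} {y} x∈ y∈ x≤y))
        , (λ y≤x → x≉y (X.Eq.sym {y} {x} (≤⇒≈ {y} {x} y∈ x∈ y≤x))))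
        (xs∈ , u)
      ∷ antichain xs∈ us

    length-levels : length (filter OnLevel? X.elements) ≡
                    ∑ n (λ p → ⟦ P? p ⟧ ℕ.* binom k (f p))
    length-levels = begin
      length (filter OnLevel? X.elements)
        ≡⟨ length-filter-sum OnLevel? X.elements ⟩
      sum (map (⟦_⟧ ∘ OnLevel?) X.elements)
        ≡⟨ sum-map-cartesianProduct (⟦_⟧ ∘ OnLevel?) (select P? (subsets n)) (subsets k) ⟩
      sum (map (λ p → sum (map (λ s → ⟦ OnLevel? (p , s) ⟧) (subsets k))) (select P? (subsets n)))
        ≡⟨ cong sum (map-cong (λ p → trans (sum-map-subsets k _) (∑-level k (f (proj₁ p))))
             (select P? (subsets n))) ⟩
      sum (map (binom k ∘ f ∘ proj₁) (select P? (subsets n)))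
        ≡⟨ sum-map-select P? (binom k ∘ f) (subsets n) ⟩
      sum (map (λ p → ⟦ P? p ⟧ ℕ.* binom k (f p)) (subsets n))
        ≡⟨ sum-map-subsets n _ ⟩
      ∑ n (λ p → ⟦ P? p ⟧ ℕ.* binom k (f p)) ∎
      where open ≡-Reasoning

-- Constructing strictly decreasing functions

pred-< : ∀ i → pred i ℤ.< i
pred-< i = ℤ.i≤pred[j]⇒i<j ℤ.≤-refl

pred-mono-< : ∀ {i j} → i ℤ.< j → pred i ℤ.< pred j
pred-mono-< = ℤ.+-monoʳ-< ℤ.-1ℤ

⊓-mono-< : ∀ {i i′ j j′} → i ℤ.< i′ → j ℤ.< j′ → i ℤ.⊓ j ℤ.< i′ ℤ.⊓ j′
⊓-mono-< {i′ = i′} {j′ = j′} i<i′ j<j′ with ℤ.⊓-sel i′ j′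
... | inj₁ eq = subst (_ ℤ.<_) (sym eq) (ℤ.≤-<-trans (ℤ.i⊓j≤i _ _) i<i′)
... | inj₂ eq = subst (_ ℤ.<_) (sym eq) (ℤ.≤-<-trans (ℤ.i⊓j≤j _ _) j<j′)

⊔-mono-< : ∀ {i i′ j j′} → i ℤ.< i′ → j ℤ.< j′ → i ℤ.⊔ j ℤ.< i′ ℤ.⊔ j′
⊔-mono-< {i} {j = j} i<i′ j<j′ with ℤ.⊔-sel i j
... | inj₁ eq = subst (ℤ._< _) (sym eq) (ℤ.<-≤-trans i<i′ (ℤ.i≤i⊔j _ _))
... | inj₂ eq = subst (ℤ._< _) (sym eq) (ℤ.<-≤-trans j<j′ (ℤ.i≤j⊔i _ _))

-- Minimum and maximum only reorder the pair i, j. Hence replacing `f₁` and `pred f₀` by their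
-- minimum and maximum leaves the sum of binomial coefficients unchanged.
⊓+⊔ : ∀ (h : ℤ → ℕ) i j → h (i ℤ.⊓ j) + h (i ℤ.⊔ j) ≡ h i + h j
⊓+⊔ h i j with ℤ.≤-total i j
... | inj₁ i≤j = cong₂ (λ x y → h x + h y) (ℤ.i≤j⇒i⊓j≡i i≤j) (ℤ.i≤j⇒i⊔j≡j i≤j)
... | inj₂ j≤i = trans (cong₂ (λ x y → h x + h y) (ℤ.i≥j⇒i⊓j≡j j≤i) (ℤ.i≥j⇒i⊔j≡i j≤i))
                       (ℕ.+-comm (h j) (h i))

module _ {P : Pred (Subset n) p} where

  StrictlyDecreasing⇒antitone : ∀ {f} → StrictlyDecreasing P f →
    ∀ {p q} → P p → P q → p ⊆ q → f q ℤ.≤ f p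
  StrictlyDecreasing⇒antitone dec {p} {q} Pp Pq p⊆q with FinitePoset._≟_ (Q n) p q
  ... | yes refl = ℤ.≤-refl
  ... | no  p≢q  = ℤ.<⇒≤ (dec Pp Pq p⊆q p≢q)

module _ {P : Pred (Subset (suc n)) p} (P? : Decidable P)
         (convex : Convex (FinitePoset.poset (Q (suc n))) P)
         (f₀ f₁ : Subset n → ℤ)
         (f₀-dec : StrictlyDecreasing (P ∘ (outside ∷_)) f₀)
         (f₁-dec : StrictlyDecreasing (P ∘ (inside ∷_)) f₁) where

  private
    P₀ P₁ : Pred (Subset n) p
    P₀ = P ∘ (outside ∷_)
    P₁ = P ∘ (inside ∷_)

    -- Convexity is applied to `outside ∷ p` ⊆ `inside ∷ p` ⊆ `inside ∷ q`, and in `P₁-upper` to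
    -- `outside ∷ p` ⊆ `outside ∷ q` ⊆ `inside ∷ q`.
    P₀-lower : ∀ {p q} → P₀ p → P₁ q → p ⊆ q → P₁ p
    P₀-lower P₀p P₁q p⊆q = convex (out⊆ ⊆-refl) (s⊆s p⊆q) P₀p P₁q

    P₁-upper : ∀ {p q} → P₀ p → P₁ q → p ⊆ q → P₀ q
    P₁-upper P₀p P₁q p⊆q = convex (s⊆s p⊆q) (out⊆ ⊆-refl) P₀p P₁q

  lower upper : Subset (suc n) → ℤ
  lower (outside ∷ p) = f₀ p
  lower (inside  ∷ p) = if does (P? (outside ∷ p)) then f₁ p ℤ.⊓ pred (f₀ p) else f₁ p
  upper (outside ∷ p) = if does (P? (inside ∷ p)) then f₁ p ℤ.⊔ pred (f₀ p) else pred (f₀ p)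
  upper (inside  ∷ p) = pred (f₁ p)

  -- The `pred` gives the strict drop from the outside half to the inside half. Within the inside
  -- half, a growing set may enter P₀, which adds an argument to the minimum and can only lower it;
  -- by `P₁-upper` it never leaves P₀ again.
  lower-dec : StrictlyDecreasing P lower
  lower-dec {outside ∷ p} {outside ∷ q} Pp Pq p⊆q p≢q =
    f₀-dec Pp Pq (drop-∷-⊆ p⊆q) (p≢q ∘ cong (outside ∷_))
  lower-dec {inside ∷ p} {outside ∷ q} Pp Pq p⊆q p≢q = contradiction (p⊆q here) λ ()
  lower-dec {outside ∷ p} {inside ∷ q} P₀p P₁q p⊆q p≢q with P? (outside ∷ q)
  ... | no ¬P₀q = contradiction (P₁-upper P₀p P₁q (drop-∷-⊆ p⊆q)) ¬P₀q
  ... | yes P₀q = begin-strict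
    f₁ q ℤ.⊓ pred (f₀ q) ≤⟨ ℤ.i⊓j≤j _ _ ⟩
    pred (f₀ q)          <⟨ pred-< (f₀ q) ⟩
    f₀ q                 ≤⟨ StrictlyDecreasing⇒antitone {P = P₀} f₀-dec P₀p P₀q (drop-∷-⊆ p⊆q) ⟩
    f₀ p                 ∎
    where open ℤ.≤-Reasoning
  lower-dec {inside ∷ p} {inside ∷ q} P₁p P₁q p⊆q p≢q
    with f₁-dec P₁p P₁q (drop-∷-⊆ p⊆q) (p≢q ∘ cong (inside ∷_))
       | P? (outside ∷ p) | P? (outside ∷ q)
  ... | f₁< | no _    | no _    = f₁<
  ... | f₁< | no _    | yes _   = ℤ.≤-<-trans (ℤ.i⊓j≤i _ _) f₁<
  ... | f₁< | yes P₀p | no ¬P₀q = contradiction (P₁-upper P₀p P₁q (drop-∷-⊆ p⊆q)) ¬P₀q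
  ... | f₁< | yes P₀p | yes P₀q =
    ⊓-mono-< f₁< (pred-mono-< (f₀-dec P₀p P₀q (drop-∷-⊆ p⊆q) (p≢q ∘ cong (inside ∷_))))

  -- Dual to `lower-dec`: within the outside half, a growing set may leave P₁, which removes an
  -- argument from the maximum and can only lower it; by `P₀-lower` it never enters P₁.
  upper-dec : StrictlyDecreasing P upper
  upper-dec {inside ∷ p} {inside ∷ q} Pp Pq p⊆q p≢q =
    pred-mono-< (f₁-dec Pp Pq (drop-∷-⊆ p⊆q) (p≢q ∘ cong (inside ∷_)))
  upper-dec {inside ∷ p} {outside ∷ q} Pp Pq p⊆q p≢q = contradiction (p⊆q here) λ ()
  upper-dec {outside ∷ p} {inside ∷ q} P₀p P₁q p⊆q p≢q with P? (inside ∷ p)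
  ... | no ¬P₁p = contradiction (P₀-lower P₀p P₁q (drop-∷-⊆ p⊆q)) ¬P₁p
  ... | yes P₁p = begin-strict
    pred (f₁ q)          <⟨ pred-< (f₁ q) ⟩
    f₁ q                 ≤⟨ StrictlyDecreasing⇒antitone {P = P₁} f₁-dec P₁p P₁q (drop-∷-⊆ p⊆q) ⟩
    f₁ p                 ≤⟨ ℤ.i≤i⊔j _ _ ⟩
    f₁ p ℤ.⊔ pred (f₀ p) ∎
    where open ℤ.≤-Reasoning
  upper-dec {outside ∷ p} {outside ∷ q} P₀p P₀q p⊆q p≢q
    with pred-mono-< (f₀-dec P₀p P₀q (drop-∷-⊆ p⊆q) (p≢q ∘ cong (outside ∷_)))
       | P? (inside ∷ p) | P? (inside ∷ q)
  ... | f₀< | no _    | no _    = f₀<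
  ... | f₀< | yes _   | no _    = ℤ.<-≤-trans f₀< (ℤ.i≤j⊔i _ _)
  ... | f₀< | no ¬P₁p | yes P₁q = contradiction (P₀-lower P₀p P₁q (drop-∷-⊆ p⊆q)) ¬P₁p
  ... | f₀< | yes P₁p | yes P₁q =
    ⊔-mono-< (f₁-dec P₁p P₁q (drop-∷-⊆ p⊆q) (p≢q ∘ cong (outside ∷_))) f₀<


  -- Equality already holds for each pair `outside ∷ p`, `inside ∷ p`. If both lie in P, the four
  -- values of `lower` and `upper` may be exchanged for f₀, f₀ - 1, f₁, f₁ - 1 by `⊓+⊔`; Pascal's
  -- rule then merges them in pairs.
  ∑-lower-upper : ∀ k →
    ∑ (suc n) (λ p → ⟦ P? p ⟧ ℕ.* binom k (lower p)) +
    ∑ (suc n) (λ p → ⟦ P? p ⟧ ℕ.* binom k (upper p)) ≡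
    ∑ n (λ p → ⟦ P? (outside ∷ p) ⟧ ℕ.* binom (suc k) (f₀ p)) +
    ∑ n (λ p → ⟦ P? (inside ∷ p) ⟧ ℕ.* binom (suc k) (f₁ p))
  ∑-lower-upper k = begin
    ∑ (suc n) (term lower) + ∑ (suc n) (term upper)
      ≡⟨ ∑-+ (suc n) (term lower) (term upper) ⟨
    ∑ n (both ∘ (outside ∷_)) + ∑ n (both ∘ (inside ∷_))
      ≡⟨ ∑-+ n _ _ ⟨
    ∑ n (λ p → both (outside ∷ p) + both (inside ∷ p))
      ≡⟨ ∑-cong n pointwise ⟩
    ∑ n (λ p → ⟦ P? (outside ∷ p) ⟧ ℕ.* binom (suc k) (f₀ p) +
               ⟦ P? (inside ∷ p) ⟧ ℕ.* binom (suc k) (f₁ p))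
      ≡⟨ ∑-+ n _ _ ⟩
    ∑ n (λ p → ⟦ P? (outside ∷ p) ⟧ ℕ.* binom (suc k) (f₀ p)) +
    ∑ n (λ p → ⟦ P? (inside ∷ p) ⟧ ℕ.* binom (suc k) (f₁ p)) ∎
    where
    open ≡-Reasoning

    term : (Subset (suc n) → ℤ) → Subset (suc n) → ℕ
    term f p = ⟦ P? p ⟧ ℕ.* binom k (f p)

    both : Subset (suc n) → ℕ
    both p = term lower p + term upper p

    -- The factors 1 are the indicators, both sets lying in P.
    swap : ∀ a b x y {c d} → x + y ≡ c + d →
           (1 ℕ.* a + 1 ℕ.* y) + (1 ℕ.* x + 1 ℕ.* b) ≡ 1 ℕ.* (a + d) + 1 ℕ.* (c + b)
    swap a b x y {c} {d} eq = begin
      (1 ℕ.* a + 1 ℕ.* y) + (1 ℕ.* x + 1 ℕ.* b) ≡⟨ lhs a b x y ⟩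
      (a + b) + (x + y)                         ≡⟨ cong (_+_ (a + b)) eq ⟩
      (a + b) + (c + d)                         ≡⟨ rhs a b c d ⟩
      1 ℕ.* (a + d) + 1 ℕ.* (c + b)             ∎
      where
      lhs : ∀ a b x y → (1 ℕ.* a + 1 ℕ.* y) + (1 ℕ.* x + 1 ℕ.* b) ≡ (a + b) + (x + y)
      lhs = solve-∀
      rhs : ∀ a b c d → (a + b) + (c + d) ≡ 1 ℕ.* (a + d) + 1 ℕ.* (c + b)
      rhs = solve-∀

    pointwise : ∀ p → both (outside ∷ p) + both (inside ∷ p) ≡
                      ⟦ P? (outside ∷ p) ⟧ ℕ.* binom (suc k) (f₀ p) +
                      ⟦ P? (inside ∷ p) ⟧ ℕ.* binom (suc k) (f₁ p)
    pointwise p with P? (outside ∷ p) | P? (inside ∷ p)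
    ... | no  _ | no  _ = refl
    ... | no  _ | yes _ = pascal (binom k (f₁ p)) _
      where
      pascal : ∀ x y → 1 ℕ.* x + 1 ℕ.* y ≡ 1 ℕ.* (x + y)
      pascal = solve-∀
    ... | yes _ | no  _ = pascal (binom k (f₀ p)) _
      where
      pascal : ∀ x y → 1 ℕ.* x + 1 ℕ.* y + 0 ≡ 1 ℕ.* (x + y) + 0
      pascal = solve-∀
    ... | yes _ | yes _ =
      swap (binom k (f₀ p)) (binom k (pred (f₁ p)))
           (binom k (f₁ p ℤ.⊓ pred (f₀ p))) (binom k (f₁ p ℤ.⊔ pred (f₀ p)))
           (⊓+⊔ (binom k) (f₁ p) (pred (f₀ p)))

-- Averaging and the induction on the dimension

larger-half : ∀ s t {u} → s + t ≡ u → u ℕ.≤ 2 ℕ.* s ⊎ u ℕ.≤ 2 ℕ.* t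
larger-half s t refl rewrite ℕ.+-identityʳ s | ℕ.+-identityʳ t with ℕ.≤-total s t
... | inj₁ s≤t = inj₂ (ℕ.+-monoˡ-≤ t s≤t)
... | inj₂ t≤s = inj₁ (ℕ.+-monoʳ-≤ s t≤s)

-- Here s and t are the sums for the two halves of P, and u is the sum for the better of `lower` and
-- `upper`. Taking the better one costs a factor 2, which turns 2ⁿ into 2ⁿ⁺¹.
average-bound : ∀ b d {x y s t u} → b ℕ.* x ℕ.≤ d ℕ.* s → b ℕ.* y ℕ.≤ d ℕ.* t →
                s + t ℕ.≤ 2 ℕ.* u → b ℕ.* (x + y) ℕ.≤ 2 ℕ.* d ℕ.* u
average-bound b d {x} {y} {s} {t} {u} bx≤ds by≤dt s+t≤2u = begin
  b ℕ.* (x + y)       ≡⟨ ℕ.*-distribˡ-+ b x y ⟩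
  b ℕ.* x + b ℕ.* y   ≤⟨ ℕ.+-mono-≤ bx≤ds by≤dt ⟩
  d ℕ.* s + d ℕ.* t   ≡⟨ ℕ.*-distribˡ-+ d s t ⟨
  d ℕ.* (s + t)       ≤⟨ ℕ.*-monoʳ-≤ d s+t≤2u ⟩
  d ℕ.* (2 ℕ.* u)     ≡⟨ ℕ.*-assoc d 2 u ⟨
  d ℕ.* 2 ℕ.* u       ≡⟨ cong (ℕ._* u) (ℕ.*-comm d 2) ⟩
  2 ℕ.* d ℕ.* u       ∎
  where open ℕ.≤-Reasoning

-- The induction lets k vary: passing to a half trades one unit of n for one of k, so n + k, and
-- with it the coefficient `binom (n + k) c`, stays fixed.
∃-strictlyDecreasing : ∀ n k c {P : Pred (Subset n) p} (P? : Decidable P) →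
  Convex (FinitePoset.poset (Q n)) P →
  ∃[ f ] StrictlyDecreasing P f ×
         binom (n + k) c ℕ.* ∑ n (⟦_⟧ ∘ P?) ℕ.≤ 2 ℕ.^ n ℕ.* ∑ n (λ p → ⟦ P? p ⟧ ℕ.* binom k (f p))
-- On the one-element cube the constant value `c` gives equality.
∃-strictlyDecreasing zero    k c P? convex =
  (λ _ → c) , (λ { {[]} {[]} _ _ _ []≢[] → contradiction refl []≢[] }) ,
  ℕ.≤-reflexive (trans (ℕ.*-comm (binom k c) ⟦ P? [] ⟧) (sym (ℕ.*-identityˡ _)))
∃-strictlyDecreasing (suc n) k c P? convex
  with ∃-strictlyDecreasing n (suc k) c (P? ∘ (outside ∷_)) (λ u⊆v v⊆w → convex (s⊆s u⊆v) (s⊆s v⊆w))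
     | ∃-strictlyDecreasing n (suc k) c (P? ∘ (inside ∷_)) (λ u⊆v v⊆w → convex (s⊆s u⊆v) (s⊆s v⊆w))
... | f₀ , f₀-dec , f₀-bound | f₁ , f₁-dec , f₁-bound
  rewrite ℕ.+-suc n k
  with larger-half (∑ (suc n) λ p → ⟦ P? p ⟧ ℕ.* binom k (lower P? convex f₀ f₁ f₀-dec f₁-dec p))
                   (∑ (suc n) λ p → ⟦ P? p ⟧ ℕ.* binom k (upper P? convex f₀ f₁ f₀-dec f₁-dec p))
                   (∑-lower-upper P? convex f₀ f₁ f₀-dec f₁-dec k)
... | inj₁ half = _ , lower-dec P? convex f₀ f₁ f₀-dec f₁-dec ,
  average-bound (binom (suc (n + k)) c) (2 ℕ.^ n) f₀-bound f₁-bound half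
... | inj₂ half = _ , upper-dec P? convex f₀ f₁ f₀-dec f₁-dec ,
  average-bound (binom (suc (n + k)) c) (2 ℕ.^ n) f₀-bound f₁-bound half

-- Sperner's theorem

module _ {c ℓ₁ ℓ₂ c′ ℓ₁′ ℓ₂′} (X : Poset c ℓ₁ ℓ₂) (Y : Poset c′ ℓ₁′ ℓ₂′) where
  private
    module X = Poset X
    module Y = Poset Y

  Antichain-map⁺ : {f : X.Carrier → Y.Carrier} → (∀ x y → f x Y.≤ f y → x X.≤ y) →
                   ∀ {xs} → Antichain X xs → Antichain Y (map f xs)
  Antichain-map⁺ reflects anti = AllPairs.map⁺
    (AllPairs.map (λ (x≰y , y≰x) → x≰y ∘ reflects _ _ , y≰x ∘ reflects _ _) anti)

module _ {c ℓ₁ ℓ₂} (X Y : Poset c ℓ₁ ℓ₂) where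
  private
    module X = Poset X
    module Y = Poset Y

  -- The members from each summand form an antichain there.
  Antichain-⊎⇒length≤ : ∀ {a b} → (∀ {xs} → Antichain X xs → length xs ℕ.≤ a) →
                        (∀ {ys} → Antichain Y ys → length ys ℕ.≤ b) →
                        ∀ {zs} → Antichain (⊎-poset X Y) zs → length zs ℕ.≤ a + b
  Antichain-⊎⇒length≤ {a} {b} X-bound Y-bound {zs} anti = begin
    length zs                              ≡⟨ length-partitionSums zs ⟩
    length (lefts zs) + length (rights zs) ≤⟨ ℕ.+-mono-≤ (X-bound (lefts⁺ anti)) (Y-bound (rights⁺ anti)) ⟩
    a + b                                  ∎
    where
    open ℕ.≤-Reasoning

    lefts : List (X.Carrier ⊎ Y.Carrier) → List X.Carrier
    lefts zs = proj₁ (partitionSums zs)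

    rights : List (X.Carrier ⊎ Y.Carrier) → List Y.Carrier
    rights zs = proj₂ (partitionSums zs)

    length-partitionSums : ∀ zs → length zs ≡ length (lefts zs) + length (rights zs)
    length-partitionSums []            = refl
    length-partitionSums (inj₁ _ ∷ zs) = cong suc (length-partitionSums zs)
    length-partitionSums (inj₂ _ ∷ zs) =
      trans (cong suc (length-partitionSums zs)) (sym (ℕ.+-suc _ _))

    All-lefts : ∀ {x zs} → All (Incomparable (⊎-poset X Y) (inj₁ x)) zs →
                All (Incomparable X x) (lefts zs)
    All-lefts {zs = []}          []             = []
    All-lefts {zs = inj₁ _ ∷ zs} ((≰ , ≱) ∷ ps) = (≰ ∘ inj₁ , ≱ ∘ inj₁) ∷ All-lefts ps
    All-lefts {zs = inj₂ _ ∷ zs} (_ ∷ ps)       = All-lefts ps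

    All-rights : ∀ {y zs} → All (Incomparable (⊎-poset X Y) (inj₂ y)) zs →
                 All (Incomparable Y y) (rights zs)
    All-rights {zs = []}          []             = []
    All-rights {zs = inj₁ _ ∷ zs} (_ ∷ ps)       = All-rights ps
    All-rights {zs = inj₂ _ ∷ zs} ((≰ , ≱) ∷ ps) = (≰ ∘ inj₂ , ≱ ∘ inj₂) ∷ All-rights ps

    lefts⁺ : ∀ {zs} → Antichain (⊎-poset X Y) zs → Antichain X (lefts zs)
    lefts⁺ {[]}          []       = []
    lefts⁺ {inj₁ _ ∷ zs} (p ∷ ps) = All-lefts p ∷ lefts⁺ ps
    lefts⁺ {inj₂ _ ∷ zs} (_ ∷ ps) = lefts⁺ ps

    rights⁺ : ∀ {zs} → Antichain (⊎-poset X Y) zs → Antichain Y (rights zs)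
    rights⁺ {[]}          []       = []
    rights⁺ {inj₁ _ ∷ zs} (_ ∷ ps) = rights⁺ ps
    rights⁺ {inj₂ _ ∷ zs} (p ∷ ps) = All-rights p ∷ rights⁺ ps

-- Sperner's theorem is proved for cubes multiplied by a chain, since splitting off a coordinate of
-- the cube then leads to posets of the same kind.
Chain×Q : ℕ → ℕ → Poset _ _ _
Chain×Q l m = Product.×-poset (Fin.≤-poset l) (FinitePoset.poset (Q m))

-- The grid of an (l + 1)-element chain and Q 1 is the union of the chain
-- (0,0) < (0,1) < (1,1) < … < (l,1) and the chain (1,0) < … < (l,0).
splitChain : ∀ {l m} → Fin (suc l) × Subset (suc m) →
             (Fin (2 + l) × Subset m) ⊎ (Fin l × Subset m)
splitChain (i         , inside  ∷ s) = inj₁ (Fin.suc i , s)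
splitChain (Fin.zero  , outside ∷ s) = inj₁ (Fin.zero , s)
splitChain (Fin.suc i , outside ∷ s) = inj₂ (i , s)

-- Each of the two pieces is a chain of the grid, and elements of different pieces become
-- incomparable. Comparabilities are only lost, so antichains stay antichains.
splitChain-reflects : ∀ l m x y →
  Poset._≤_ (⊎-poset (Chain×Q (2 + l) m) (Chain×Q l m)) (splitChain x) (splitChain y) →
  Poset._≤_ (Chain×Q (suc l) (suc m)) x y
splitChain-reflects _ _ (_         , inside  ∷ _) (_         , inside  ∷ _) (inj₁ (s≤s i≤j , s⊆t)) = i≤j , s⊆s s⊆t
splitChain-reflects _ _ (_         , inside  ∷ _) (Fin.zero  , outside ∷ _) (inj₁ (() , _))
splitChain-reflects _ _ (_         , inside  ∷ _) (Fin.suc _ , outside ∷ _) ()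
splitChain-reflects _ _ (Fin.zero  , outside ∷ _) (_         , inside  ∷ _) (inj₁ (_ , s⊆t))       = z≤n , out⊆ s⊆t
splitChain-reflects _ _ (Fin.suc _ , outside ∷ _) (_         , inside  ∷ _) ()
splitChain-reflects _ _ (Fin.zero  , outside ∷ _) (Fin.zero  , outside ∷ _) (inj₁ (_ , s⊆t))       = z≤n , s⊆s s⊆t
splitChain-reflects _ _ (Fin.zero  , outside ∷ _) (Fin.suc _ , outside ∷ _) ()
splitChain-reflects _ _ (Fin.suc _ , outside ∷ _) (Fin.zero  , outside ∷ _) ()
splitChain-reflects _ _ (Fin.suc _ , outside ∷ _) (Fin.suc _ , outside ∷ _) (inj₂ (i≤j , s⊆t))     = s≤s i≤j , s⊆s s⊆t

-- The sum of binom m over c, ..., c + l - 1. It is the number of pairs of rank c + l - 1 in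
-- `Chain×Q l m`.
window : ℕ → ℤ → ℕ → ℕ
window m c zero    = 0
window m c (suc l) = binom m c + window m (ℤ.suc c) l

window-pascal : ∀ m c l → window (suc m) c l ≡ window m c l + window m (pred c) l
window-pascal m c zero    = refl
window-pascal m c (suc l) = begin
  (binom m c + binom m (pred c)) + window (suc m) (ℤ.suc c) l
    ≡⟨ cong (λ x → binom m c + binom m (pred c) + x) (window-pascal m (ℤ.suc c) l) ⟩
  (binom m c + binom m (pred c)) + (window m (ℤ.suc c) l + window m (pred (ℤ.suc c)) l)
    ≡⟨ cong (λ i → (binom m c + binom m (pred c)) + (window m (ℤ.suc c) l + window m i l))
         (trans (ℤ.pred-suc c) (sym (ℤ.suc-pred c))) ⟩
  (binom m c + binom m (pred c)) + (window m (ℤ.suc c) l + window m (ℤ.suc (pred c)) l)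
    ≡⟨ interchange ℕ.+-commutativeSemigroup (binom m c) _ _ _ ⟩
  window m c (suc l) + window m (pred c) (suc l) ∎
  where open ≡-Reasoning

-- Pascal's rule gives the ranges c, ..., c + l and c - 1, ..., c + l - 1; moving the end point c -
-- 1 from the second to the first leaves lengths l + 2 and l, those of the two chains in
-- `splitChain`.
window-split : ∀ m c l → window m (pred c) (2 + l) + window m c l ≡ window (suc m) c (suc l)
window-split m c l = begin
  (binom m (pred c) + window m (ℤ.suc (pred c)) (suc l)) + window m c l
    ≡⟨ cong (λ i → binom m (pred c) + window m i (suc l) + window m c l) (ℤ.suc-pred c) ⟩
  (binom m (pred c) + window m c (suc l)) + window m c l
    ≡⟨ cong (_+ window m c l) (ℕ.+-comm (binom m (pred c)) _) ⟩
  (window m c (suc l) + binom m (pred c)) + window m c l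
    ≡⟨ ℕ.+-assoc (window m c (suc l)) _ _ ⟩
  window m c (suc l) + (binom m (pred c) + window m c l)
    ≡⟨ cong (λ i → window m c (suc l) + (binom m (pred c) + window m i l)) (ℤ.suc-pred c) ⟨
  window m c (suc l) + window m (pred c) (suc l)
    ≡⟨ window-pascal m c (suc l) ⟨
  window (suc m) c (suc l) ∎
  where open ≡-Reasoning

-- The window c, …, c + l − 1 is centred in 0, …, m, up to rounding.
Central : ℕ → ℤ → ℕ → Set
Central m c l = c ℤ.+ c ℤ.+ + l ≡ + m ⊎ c ℤ.+ c ℤ.+ + l ≡ + suc m

-- The quantity 2c + l drops by one together with m, both when the window loses its last point and,
-- in `Central-grow`, when it gains one on the left.
Central-shrink : ∀ {m c l} → Central (suc m) c (suc l) → Central m c l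
Central-shrink {m} {c} {l} = Sum.map (shrink m) (shrink (suc m))
  where
  identity : ∀ c l → c ℤ.+ c ℤ.+ l ≡ ℤ.-1ℤ ℤ.+ (c ℤ.+ c ℤ.+ (ℤ.1ℤ ℤ.+ l))
  identity = ℤ-Solver.solve-∀

  shrink : ∀ r → c ℤ.+ c ℤ.+ + suc l ≡ + suc r → c ℤ.+ c ℤ.+ + l ≡ + r
  shrink r eq = trans (identity c (+ l)) (cong pred eq)

Central-grow : ∀ {m c l} → Central (suc m) c (suc l) → Central m (pred c) (2 + l)
Central-grow {m} {c} {l} = Sum.map (grow m) (grow (suc m))
  where
  identity : ∀ c l → (ℤ.-1ℤ ℤ.+ c) ℤ.+ (ℤ.-1ℤ ℤ.+ c) ℤ.+ (+ 2 ℤ.+ l) ≡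
                     ℤ.-1ℤ ℤ.+ (c ℤ.+ c ℤ.+ (ℤ.1ℤ ℤ.+ l))
  identity = ℤ-Solver.solve-∀

  grow : ∀ r → c ℤ.+ c ℤ.+ + suc l ≡ + suc r → pred c ℤ.+ pred c ℤ.+ + (2 + l) ≡ + r
  grow r eq = trans (identity c (+ l)) (cong pred eq)

-- The window starts at -a and is long enough to contain 0, where `binom 0` is 1.
window-zero-positive : ∀ a {l} → a ℕ.< l → 1 ℕ.≤ window 0 (ℤ.- + a) l
window-zero-positive zero          (s≤s _)   = s≤s z≤n
window-zero-positive (suc zero)    (s≤s a<l) = window-zero-positive zero a<l
window-zero-positive (suc (suc a)) (s≤s a<l) = window-zero-positive (suc a) a<l

-- A nonempty centred window for m = 0 contains 0: a start above 0 makes 2c + l + 1 too large, and a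
-- start at -(a + 1) forces length at least 2(a + 1).
Central-zero⇒window-positive : ∀ c l → Central 0 c (suc l) → 1 ℕ.≤ window 0 c (suc l)
Central-zero⇒window-positive (+ zero)  l _ = s≤s z≤n
Central-zero⇒window-positive (+ suc a) l (inj₂ eq)
  with () ← ℕ.m+n≡0⇒n≡0 (a + suc a) (ℕ.suc-injective (ℤ.+-injective eq))
Central-zero⇒window-positive -[1+ a ]  l central = window-zero-positive (suc a)
  (case central of λ where
    (inj₁ eq) → a<l 0 eq
    (inj₂ eq) → a<l 1 eq)
  where
  identity : ∀ c l → l ≡ (c ℤ.+ c ℤ.+ l) ℤ.+ (ℤ.- c ℤ.+ ℤ.- c)
  identity = ℤ-Solver.solve-∀

  a<l : ∀ r → -[1+ a ] ℤ.+ -[1+ a ] ℤ.+ + suc l ≡ + r → suc a ℕ.< suc l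
  a<l r eq = begin-strict
    suc a               <⟨ ℕ.m<n+m (suc a) ℕ.z<s ⟩
    suc a + suc a       ≤⟨ ℕ.m≤n+m _ r ⟩
    r + (suc a + suc a) ≡⟨ ℤ.+-injective (trans (identity -[1+ a ] (+ suc l))
                             (cong (ℤ._+ + (suc a + suc a)) eq)) ⟨
    suc l               ∎
    where open ℕ.≤-Reasoning

-- Induction on m, with c and l varying: `splitChain` cuts the antichain into one for a chain of
-- length l + 2 and one for a chain of length l, and the two bounds add up by `window-split`.
antichain≤window : ∀ m c l → Central m c l → ∀ {xs} → Antichain (Chain×Q l m) xs →
                   length xs ℕ.≤ window m c l
antichain≤window m       c zero    central {[]}          _ = z≤n
antichain≤window m       c zero    central {(() , _) ∷ _}
antichain≤window zero    c (suc l) central {[]}          _ = z≤n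
-- For m = 0 the poset is a chain, so one element is the most; centredness ensures that the window
-- counts it.
antichain≤window zero    c (suc l) central {_ ∷ []}      _ = Central-zero⇒window-positive c l central
antichain≤window zero    c (suc l) central {(i , []) ∷ (j , []) ∷ _} (((≰ , ≱) ∷ _) ∷ _)
  with ℕ.≤-total (Fin.toℕ i) (Fin.toℕ j)
... | inj₁ i≤j = contradiction (i≤j , λ ()) ≰
... | inj₂ j≤i = contradiction (j≤i , λ ()) ≱
antichain≤window (suc m) c (suc l) central {xs} anti = begin
  length xs
    ≡⟨ length-map splitChain xs ⟨
  length (map splitChain xs)
    ≤⟨ Antichain-⊎⇒length≤ (Chain×Q (2 + l) m) (Chain×Q l m)
         (antichain≤window m (pred c) (2 + l) (Central-grow {c = c} central))
         (antichain≤window m c l (Central-shrink {c = c} central))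
         (Antichain-map⁺ (Chain×Q (suc l) (suc m)) (⊎-poset (Chain×Q (2 + l) m) (Chain×Q l m))
           (splitChain-reflects l m) anti) ⟩
  window m (pred c) (2 + l) + window m c l
    ≡⟨ window-split m c l ⟩
  window (suc m) c (suc l) ∎
  where open ℕ.≤-Reasoning

-- Odd m gives the first alternative, even m the second.
Central-middle : ∀ m → Central m (+ ℕ.⌊ m /2⌋) 1
Central-middle m = Sum.map (cong λ i → + i) (cong λ i → + i) (middle m)
  where
  middle : ∀ m → ℕ.⌊ m /2⌋ + ℕ.⌊ m /2⌋ + 1 ≡ m ⊎ ℕ.⌊ m /2⌋ + ℕ.⌊ m /2⌋ + 1 ≡ suc m
  middle zero          = inj₂ refl
  middle (suc zero)    = inj₁ refl
  middle (suc (suc m)) rewrite ℕ.+-suc ℕ.⌊ m /2⌋ ℕ.⌊ m /2⌋ =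
    Sum.map (cong (suc ∘ suc)) (cong (suc ∘ suc)) (middle m)

-- This is the case of a one-element chain, where the centred window is the middle binomial
-- coefficient alone.
sperner : ∀ m → width (Q m) ℕ.≤ binom m (+ ℕ.⌊ m /2⌋)
sperner m with width-attained (Q m)
... | xs , anti , length≡ = begin
  width (Q m)                      ≡⟨ length≡ ⟨
  length xs                        ≡⟨ length-map embed xs ⟨
  length (map embed xs)
    ≤⟨ antichain≤window m _ 1 (Central-middle m)
         (Antichain-map⁺ (FinitePoset.poset (Q m)) (Chain×Q 1 m) {f = embed} (λ _ _ → proj₂) anti) ⟩
  window m (+ ℕ.⌊ m /2⌋) 1         ≡⟨ ℕ.+-identityʳ _ ⟩
  binom m (+ ℕ.⌊ m /2⌋)            ∎
  where
  open ℕ.≤-Reasoning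
  embed : Subset m → Fin 1 × Subset m
  embed s = Fin.zero , s

-- From natural numbers to rationals

fromℕ-*-/-≤ : ∀ a b d c .⦃ _ : ℕ.NonZero d ⦄ → a ℕ.* b ℕ.≤ d ℕ.* c →
              fromℕ a * fromℕ b * (+ 1 / d) ≤ fromℕ c
fromℕ-*-/-≤ a b (suc d) c ab≤dc = ℚ.toℚᵘ-cancel-≤ (begin
  toℚᵘ (fromℕ a * fromℕ b * (+ 1 / suc d))
    ≃⟨ ℚ.toℚᵘ-homo-* (fromℕ a * fromℕ b) (+ 1 / suc d) ⟩
  toℚᵘ (fromℕ a * fromℕ b) ℚᵘ.* toℚᵘ (+ 1 / suc d)
    ≃⟨ ℚᵘ.*-cong (ℚ.toℚᵘ-homo-* (fromℕ a) (fromℕ b)) (ℚ.toℚᵘ-fromℚᵘ (mkℚᵘ (+ 1) d)) ⟩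
  toℚᵘ (fromℕ a) ℚᵘ.* toℚᵘ (fromℕ b) ℚᵘ.* mkℚᵘ (+ 1) d
    ≃⟨ ℚᵘ.*-congʳ (ℚᵘ.*-cong (ℚ.toℚᵘ-fromℚᵘ (mkℚᵘ (+ a) 0)) (ℚ.toℚᵘ-fromℚᵘ (mkℚᵘ (+ b) 0))) ⟩
  mkℚᵘ (+ a) 0 ℚᵘ.* mkℚᵘ (+ b) 0 ℚᵘ.* mkℚᵘ (+ 1) d
    -- Unnormalised fractions compare by cross-multiplication, which is `ab≤dc` up to factors 1.
    ≤⟨ ℚᵘ.*≤* (subst₂ ℤ._≤_ lhs rhs (ℤ.+≤+ ab≤dc)) ⟩
  mkℚᵘ (+ c) 0
    ≃⟨ ℚ.toℚᵘ-fromℚᵘ (mkℚᵘ (+ c) 0) ⟨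
  toℚᵘ (fromℕ c) ∎)
  where
  open ℚᵘ.≤-Reasoning

  lhs : + (a ℕ.* b) ≡ + a ℤ.* + b ℤ.* + 1 ℤ.* + 1
  lhs = trans (ℤ.pos-* a b) (sym (trans (ℤ.*-identityʳ _) (ℤ.*-identityʳ _)))

  rhs : + (suc d ℕ.* c) ≡ + c ℤ.* + (1 ℕ.* suc d)
  rhs = trans (cong (λ i → + i) (trans (ℕ.*-comm (suc d) c) (cong (c ℕ.*_) (sym (ℕ.*-identityˡ (suc d))))))
              (ℤ.pos-* c (1 ℕ.* suc d))

width*size≤2^n*width : ∀ (n k : ℕ) {P : Pred (Subset n) p} (P? : Decidable P) →
  Convex (FinitePoset.poset (Q n)) P →
  width (Q (n + k)) ℕ.* size ⟨ P? ⟩ ℕ.≤ 2 ℕ.^ n ℕ.* width (⟨ P? ⟩ ×ᶠ Q k)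
width*size≤2^n*width n k P? convex =
  let f , f-dec , bound = ∃-strictlyDecreasing n k (+ ℕ.⌊ n + k /2⌋) P? convex in begin
  width (Q (n + k)) ℕ.* size ⟨ P? ⟩
    ≤⟨ ℕ.*-mono-≤ (sperner (n + k)) (ℕ.≤-reflexive (size-⟨⟩ P?)) ⟩
  binom (n + k) (+ ℕ.⌊ n + k /2⌋) ℕ.* ∑ n (⟦_⟧ ∘ P?)
    ≤⟨ bound ⟩
  2 ℕ.^ n ℕ.* ∑ n (λ p → ⟦ P? p ⟧ ℕ.* binom k (f p))
    ≤⟨ ℕ.*-monoʳ-≤ (2 ℕ.^ n) (∑≤width P? k f-dec) ⟩
  2 ℕ.^ n ℕ.* width (⟨ P? ⟩ ×ᶠ Q k) ∎
  where open ℕ.≤-Reasoning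

theorem1 : ∀ (n k : ℕ) {p} {P : Pred (Subset n) p} (P? : Decidable P) →
    Convex (FinitePoset.poset (Q n)) P →
    fromℕ (width (⟨ P? ⟩ ×ᶠ Q k)) ≥ fromℕ (width (Q (n + k))) * fromℕ (size ⟨ P? ⟩) * (2^- n)
theorem1 n k P? convex =
  fromℕ-*-/-≤ (width (Q (n + k))) (size ⟨ P? ⟩) (2 ℕ.^ n) (width (⟨ P? ⟩ ×ᶠ Q k))
    ⦃ ℕ.m^n≢0 2 n ⦄ (width*size≤2^n*width n k P? convex)
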